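{- Let $X$ be an $n$-premaniplex and let $\xi:\Pi(X)\to\Gamma$ be a voltage assignment such that the derived graph $X^\xi$ is a maniplex. Then $X^\xi$ is the flag graph of a polytope if and only if $$\xi(\Pi^{x,y}_I(X))\cap\xi(\Pi^{x,y}_J(X))=\xi(\Pi^{x,y}_{I\cap J}(X))$$ for all $I,J\subset\{0,\dots,n-1\}$ and all vertices $x,y$ of $X$.
   Context: **Polytopes.** A poset is flagged if it has a least and a greatest element and all its maximal chains (flags) have the same finite cardinality, say $n+2$; it then has an order-preserving rank function onto $\{ -1,0,\dots,n\}$. Two flags are $i$-adjacent if they differ exactly in their element of rank $i$. An (abstract) $n$-polytope is a flagged poset with rank function onto $\{ -1,\dots,n\}$ such that (diamond condition) for each flag $\Phi$ and each $i\in\{0,\dots,n-1\}$ there is a unique flag that is $i$-adjacent to $\Phi$; and (strong flag connectedness) any two flags $\Phi,\Psi$ are joined by a sequence of flags, consecutive ones adjacent, all containing $\Phi\cap\Psi$. The flag graph of a polytope has the flags as vertices, with an edge of colour $i$ joining each pair of $i$-adjacent flags. An edge-coloured graph "is the flag graph of a polytope" if it is isomorphic, by a colour-preserving isomorphism, to the flag graph of some $n$-polytope. **Graphs.** Graphs may have parallel edges and semi-edges. Every edge consists of darts; a dart $d$ has an initial vertex, a terminal vertex and an inverse dart $d^{ -1}$; an edge joining two different vertices (a link) consists of two mutually inverse darts, and a semi-edge consists of a single dart $d=d^{ -1}$ with both ends at the same vertex. An $n$-premaniplex is a connected graph with edges coloured by $\{0,\dots,n-1\}$, all of whose edges are links or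 semi-edges, such that each vertex is incident to exactly one edge of each colour, and such that if $|i-j|>1$ every path of length $4$ alternating between colours $i$ and $j$ is closed. An $n$-maniplex is an $n$-regular connected simple graph (no semi-edges, no parallel edges) with a proper edge colouring with colours $\{0,\dots,n-1\}$ such that if $|i-j|>1$ the subgraph formed by edges of colours $i,j$ is a disjoint union of $4$-cycles. **Voltages.** A voltage assignment $\xi:\Pi(X)\to\Gamma$ into a group $\Gamma$ is a groupoid antimorphism from the fundamental groupoid of $X$; equivalently, it assigns to each dart $d$ an element $\xi(d)\in\Gamma$ with $\xi(d^{ -1})=\xi(d)^{ -1}$ and is extended to paths by $\xi(d_1d_2\cdots d_k)=\xi(d_k)\cdots\xi(d_1)$ (empty paths have trivial voltage). The derived graph $X^\xi$ has vertex set $V\times\Gamma$ and dart set $D\times\Gamma$ ($V$, $D$ the vertices and darts of $X$); the dart $(d,g)$, where $d$ goes from $x$ to $y$, goes from $(x,g)$ to $(y,\xi(d)g)$, has inverse $(d^{ -1},\xi(d)g)$ and has the colour of $d$. For vertices $x,y$ and a set of colours $I$, $\Pi_I^{x,y}(X)$ is the set of (homotopy classes of) paths from $x$ to $y$ using only darts with colours in $I$, and $\xi(\Pi_I^{x,y}(X))\subset\Gamma$ is the set of voltages of all such paths. -}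

module Defs where

open import Algebra.Bundles using (Group)
import Algebra.Properties.Group as GroupProperties
open import Data.Fin using (Fin; toℕ; inject₁; suc)
open import Data.Fin.Subset using (Subset; _∈_; ⊤)
open import Data.Nat using (ℕ; _+_; _<_; _>_; ∣_-_∣)
open import Data.Product using (Σ; ∃; ∃-syntax; ∃!; _×_; _,_; proj₁)
open import Data.Product.Relation.Binary.Pointwise.NonDependent using (×-setoid)
open import Data.Sum using (_⊎_)
open import Function.Bundles using (Bijection; Equivalence; Inverse; _⇔_; mk⇔)
open import Function.Definitions using (StrictlySurjective)
open import Level using (Level; _⊔_) renaming (suc to lsuc)
open import Relation.Binary.Bundles using (Setoid; Poset)
open import Relation.Binary.Definitions using (Minimum; Maximum; _Respects_)
import Relation.Binary.Construct.On as On
import Relation.Binary.Properties.Poset as PosetProperties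
open import Relation.Binary.PropositionalEquality as ≡ using (_≡_; _≢_)
import Relation.Binary.Reasoning.Setoid as SetoidReasoning
open import Relation.Nullary using (¬_)
open import Relation.Unary using (Pred; _⊆_; _∩_; _≐_)
open import Relation.Unary.Relation.Binary.Equality using (≐-setoid)

private
  variable
    c ℓ c′ ℓ′ : Level

HasCardinality : (S : Setoid c ℓ) → Pred (Setoid.Carrier S) ℓ′ → ℕ → Set (c ⊔ ℓ ⊔ ℓ′)
HasCardinality S A k =
  Bijection (≡.setoid (Fin k)) (On.setoid {B = Σ (Setoid.Carrier S) A} S proj₁)

------------------------------------------------------------------------
-- Edge-coloured graphs.  Vertices and darts are setoids, so that derived
-- graphs over a `Group` (whose equality is `_≈_`) are again such graphs.
-- An edge is a pair {d , inv d}.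

record ColouredGraph (n : ℕ) (c ℓ : Level) : Set (lsuc (c ⊔ ℓ)) where
  field
    vertices : Setoid c ℓ
    darts    : Setoid c ℓ

  open Setoid vertices public using () renaming
    (Carrier to Vertex; _≈_ to _≈ᵥ_; refl to ≈ᵥ-refl; sym to ≈ᵥ-sym; trans to ≈ᵥ-trans)
  open Setoid darts public using () renaming
    (Carrier to Dart; _≈_ to _≈ₑ_; refl to ≈ₑ-refl; sym to ≈ₑ-sym; trans to ≈ₑ-trans)

  field
    init term   : Dart → Vertex
    inv         : Dart → Dart
    colour      : Dart → Fin n
    init-cong   : ∀ {d e} → d ≈ₑ e → init d ≈ᵥ init e
    term-cong   : ∀ {d e} → d ≈ₑ e → term d ≈ᵥ term e
    inv-cong    : ∀ {d e} → d ≈ₑ e → inv d ≈ₑ inv e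
    colour-cong : ∀ {d e} → d ≈ₑ e → colour d ≡ colour e
    inv-inv     : ∀ d → inv (inv d) ≈ₑ d
    init-inv    : ∀ d → init (inv d) ≈ᵥ term d
    term-inv    : ∀ d → term (inv d) ≈ᵥ init d
    colour-inv  : ∀ d → colour (inv d) ≡ colour d

  IsLink : Dart → Set ℓ
  IsLink d = ¬ init d ≈ᵥ term d

  -- Both ends of a semi-edge agree by `init-inv` and `init-cong`.
  IsSemiEdge : Dart → Set ℓ
  IsSemiEdge d = d ≈ₑ inv d

  SameEdge : Dart → Dart → Set ℓ
  SameEdge d e = e ≈ₑ d ⊎ e ≈ₑ inv d

  Incident : Vertex → Dart → Set ℓ
  Incident v d = init d ≈ᵥ v ⊎ term d ≈ᵥ v

  data Path (I : Subset n) : Vertex → Vertex → Set (c ⊔ ℓ) where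
    nil  : ∀ {x y} → x ≈ᵥ y → Path I x y
    cons : ∀ {x y} (d : Dart) → init d ≈ᵥ x → colour d ∈ I →
           Path I (term d) y → Path I x y

  Connected : Set (c ⊔ ℓ)
  Connected = Vertex × (∀ x y → Path ⊤ x y)

  record IsSimple : Set (c ⊔ ℓ) where
    field
      allLinks   : ∀ d → IsLink d
      noParallel : ∀ d e → init d ≈ᵥ init e → term d ≈ᵥ term e → SameEdge d e

  -- Degree counted in darts; for graphs without loops this is the number
  -- of incident edges.
  Regular : ℕ → Set (c ⊔ ℓ)
  Regular k = ∀ v → HasCardinality darts (λ d → init d ≈ᵥ v) k

  ProperColouring : Set (c ⊔ ℓ)
  ProperColouring = ∀ v d e → Incident v d → Incident v e →
                    colour d ≡ colour e → SameEdge d e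

  -- The connected component of v in the subgraph of edges with colour i or j
  -- is a 4-cycle: v lies on a 4-cycle in that subgraph, and every edge of the
  -- subgraph that meets the cycle is one of its four edges.
  record FourCycleComponent (i j : Fin n) (v : Vertex) : Set (c ⊔ ℓ) where
    field
      d₀ d₁ d₂ d₃ : Dart
      start : init d₀ ≈ᵥ v
      join₀ : term d₀ ≈ᵥ init d₁
      join₁ : term d₁ ≈ᵥ init d₂
      join₂ : term d₂ ≈ᵥ init d₃
      join₃ : term d₃ ≈ᵥ init d₀

    OnCycle : Dart → Set ℓ
    OnCycle e = SameEdge d₀ e ⊎ SameEdge d₁ e ⊎ SameEdge d₂ e ⊎ SameEdge d₃ e

    MeetsCycle : Dart → Set ℓ
    MeetsCycle e = Incident (init d₀) e ⊎ Incident (init d₁) e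
                 ⊎ Incident (init d₂) e ⊎ Incident (init d₃) e

    field
      distinct₀₁ : ¬ init d₀ ≈ᵥ init d₁
      distinct₀₂ : ¬ init d₀ ≈ᵥ init d₂
      distinct₀₃ : ¬ init d₀ ≈ᵥ init d₃
      distinct₁₂ : ¬ init d₁ ≈ᵥ init d₂
      distinct₁₃ : ¬ init d₁ ≈ᵥ init d₃
      distinct₂₃ : ¬ init d₂ ≈ᵥ init d₃
      coloured   : ∀ e → OnCycle e → colour e ≡ i ⊎ colour e ≡ j
      component  : ∀ e → colour e ≡ i ⊎ colour e ≡ j → MeetsCycle e → OnCycle e

  record IsPremaniplex : Set (c ⊔ ℓ) where
    field
      connected      : Connected
      linkOrSemiEdge : ∀ d → IsLink d ⊎ IsSemiEdge d
      oneOfEachColour : ∀ v i → ∃! SameEdge (λ d → colour d ≡ i × Incident v d)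
      squares : ∀ i j → ∣ toℕ i - toℕ j ∣ > 1 → ∀ d₁ d₂ d₃ d₄ →
                colour d₁ ≡ i → colour d₂ ≡ j → colour d₃ ≡ i → colour d₄ ≡ j →
                term d₁ ≈ᵥ init d₂ → term d₂ ≈ᵥ init d₃ → term d₃ ≈ᵥ init d₄ →
                term d₄ ≈ᵥ init d₁

  record IsManiplex : Set (c ⊔ ℓ) where
    field
      connected : Connected
      simple    : IsSimple
      regular   : Regular n
      proper    : ProperColouring
      squares   : ∀ i j → ∣ toℕ i - toℕ j ∣ > 1 → ∀ v → FourCycleComponent i j v

record _≅_ {n} (G : ColouredGraph n c ℓ) (H : ColouredGraph n c′ ℓ′) :
           Set (c ⊔ ℓ ⊔ c′ ⊔ ℓ′) where
  private
    module G = ColouredGraph G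
    module H = ColouredGraph H
  field
    onVertices : Inverse G.vertices H.vertices
    onDarts    : Inverse G.darts H.darts

  open Inverse onVertices using () renaming (to to fᵥ)
  open Inverse onDarts using () renaming (to to fₑ)

  field
    preserves-init   : ∀ d → H.init (fₑ d) H.≈ᵥ fᵥ (G.init d)
    preserves-term   : ∀ d → H.term (fₑ d) H.≈ᵥ fᵥ (G.term d)
    preserves-inv    : ∀ d → H.inv (fₑ d) H.≈ₑ fₑ (G.inv d)
    preserves-colour : ∀ d → H.colour (fₑ d) ≡ G.colour d

------------------------------------------------------------------------
-- Voltage assignments, given by their values on darts.

module _ {n} (X : ColouredGraph n c ℓ) (Γ : Group c′ ℓ′) where

  open ColouredGraph X
  private module Γ = Group Γ

  record VoltageAssignment : Set (c ⊔ ℓ ⊔ c′ ⊔ ℓ′) where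
    field
      ξ      : Dart → Γ.Carrier
      ξ-cong : ∀ {d e} → d ≈ₑ e → ξ d Γ.≈ ξ e
      ξ-inv  : ∀ d → ξ (inv d) Γ.≈ ξ d Γ.⁻¹

    voltage : ∀ {I x y} → Path I x y → Γ.Carrier
    voltage (nil _)        = Γ.ε
    voltage (cons d _ _ p) = voltage p Γ.∙ ξ d

    -- ξ(Π_I^{x,y}(X)).  The voltage is invariant under homotopy, so ranging
    -- over paths or over their homotopy classes yields the same set.
    voltages : Subset n → Vertex → Vertex → Pred Γ.Carrier (c ⊔ ℓ ⊔ ℓ′)
    voltages I x y g = ∃[ p ] (voltage {I} {x} {y} p Γ.≈ g)

module _ {n} {X : ColouredGraph n c ℓ} {Γ : Group c′ ℓ′}
         (voltageAssignment : VoltageAssignment X Γ) where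

  open ColouredGraph X
  open VoltageAssignment voltageAssignment
  private module Γ = Group Γ

  private
    cancel : ∀ d g → ξ (inv d) Γ.∙ (ξ d Γ.∙ g) Γ.≈ g
    cancel d g = begin
      ξ (inv d) Γ.∙ (ξ d Γ.∙ g) ≈⟨ Γ.∙-congʳ (ξ-inv d) ⟩
      ξ d Γ.⁻¹ Γ.∙ (ξ d Γ.∙ g)  ≈⟨ GroupProperties.\\-leftDividesʳ Γ (ξ d) g ⟩
      g                         ∎
      where open SetoidReasoning Γ.setoid

  derivedGraph : ColouredGraph n (c ⊔ c′) (ℓ ⊔ ℓ′)
  derivedGraph = record
    { vertices    = ×-setoid vertices Γ.setoid
    ; darts       = ×-setoid darts Γ.setoid
    ; init        = λ (d , g) → init d , g
    ; term        = λ (d , g) → term d , ξ d Γ.∙ g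
    ; inv         = λ (d , g) → inv d , ξ d Γ.∙ g
    ; colour      = λ (d , _) → colour d
    ; init-cong   = λ (p , q) → init-cong p , q
    ; term-cong   = λ (p , q) → term-cong p , Γ.∙-cong (ξ-cong p) q
    ; inv-cong    = λ (p , q) → inv-cong p , Γ.∙-cong (ξ-cong p) q
    ; colour-cong = λ (p , _) → colour-cong p
    ; inv-inv     = λ (d , g) → inv-inv d , cancel d g
    ; init-inv    = λ (d , g) → init-inv d , Γ.refl
    ; term-inv    = λ (d , g) → term-inv d , cancel d g
    ; colour-inv  = λ (d , _) → colour-inv d
    }

------------------------------------------------------------------------
-- Flags of a poset are its maximal chains, as subsets closed under `_≈_`.
-- A maximal chain need not have its elements exhibited (nor `IsFlagged` be
-- provable for a concrete poset) constructively: the notions below are read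
-- in a classical metatheory, and theorems about them assume excluded middle.

module _ {p} (P : Poset p p p) where

  open Poset P

  record IsChain (C : Pred Carrier p) : Set p where
    field
      respects   : C Respects _≈_
      comparable : ∀ {x y} → C x → C y → x ≤ y ⊎ y ≤ x

  record Flag : Set (lsuc p) where
    field
      subset  : Pred Carrier p
      isChain : IsChain subset
      maximal : ∀ D → IsChain D → subset ⊆ D → D ⊆ subset

  open Flag public using (subset)

  _≐ᶠ_ : Flag → Flag → Set p
  Φ ≐ᶠ Ψ = subset Φ ≐ subset Ψ

  record IsFlagged (n : ℕ) : Set (lsuc p) where
    field
      least       : ∃ (Minimum _≤_)
      greatest    : ∃ (Maximum _≤_)
      cardinality : ∀ Φ → HasCardinality Eq.setoid (subset Φ) (2 + n)

-- Ranks -1, 0, …, n are represented by Fin (2 + n), shifted by one.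

properRank : ∀ {n} → Fin n → Fin (2 + n)
properRank i = suc (inject₁ i)

module _ {p} (P : Poset p p p) {n} (rank : Poset.Carrier P → Fin (2 + n)) where

  open Poset P

  record Adjacent (i : Fin n) (Φ Ψ : Flag P) : Set p where
    field
      agree  : ∀ x → rank x ≢ properRank i → subset Φ x ⇔ subset Ψ x
      differ : ∀ x y → rank x ≡ properRank i → rank y ≡ properRank i →
               subset Φ x → subset Ψ y → ¬ x ≈ y

  data FlagSequence (S : Pred Carrier p) : Flag P → Flag P → Set (lsuc p) where
    stop : ∀ {Φ Ψ} → S ⊆ subset Φ → _≐ᶠ_ P Φ Ψ → FlagSequence S Φ Ψ
    step : ∀ {Φ Χ Ψ} → S ⊆ subset Φ → ∀ i → Adjacent i Φ Χ →
           FlagSequence S Χ Ψ → FlagSequence S Φ Ψ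

-- In a flagged poset the rank function is unique: a strictly monotone map is
-- injective on each flag, and the flag has as many elements as there are ranks.
-- Mere weak monotonicity would not determine it.

record Polytope (n : ℕ) (p : Level) : Set (lsuc p) where
  field
    poset     : Poset p p p
    isFlagged : IsFlagged poset n

  open Poset poset
  open PosetProperties poset using () renaming (_<_ to _⊏_)

  field
    rank      : Carrier → Fin (2 + n)
    rank-cong : ∀ {x y} → x ≈ y → rank x ≡ rank y
    rank-mono : ∀ {x y} → x ⊏ y → toℕ (rank x) < toℕ (rank y)
    rank-onto : StrictlySurjective _≡_ rank
    diamond   : ∀ Φ (i : Fin n) → ∃! (_≐ᶠ_ poset) (Adjacent poset rank i Φ)
    stronglyFlagConnected :
      ∀ Φ Ψ → FlagSequence poset rank (subset Φ ∩ subset Ψ) Φ Ψ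

module _ {n p} (P : Polytope n p) where

  open Polytope P

  record FlagDart : Set (lsuc p) where
    field
      source target : Flag poset
      label         : Fin n
      adjacent      : Adjacent poset rank label source target

  open FlagDart

  private
    flags : Setoid (lsuc p) p
    flags = On.setoid (≐-setoid (Poset.Carrier poset) p) (Flag.subset {P = poset})

    flagDarts : Setoid (lsuc p) p
    flagDarts = On.setoid (×-setoid (≡.setoid (Fin n)) (×-setoid flags flags))
                          (λ d → label d , source d , target d)

    reverse : FlagDart → FlagDart
    reverse d = record
      { source   = target d
      ; target   = source d
      ; label    = label d
      ; adjacent = record
        { agree  = λ x r → let a = Adjacent.agree (adjacent d) x r
                           in mk⇔ (Equivalence.from a) (Equivalence.to a)
        ; differ = λ x y rx ry x∈ y∈ x≈y →
                   Adjacent.differ (adjacent d) y x ry rx y∈ x∈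
                     (Poset.Eq.sym poset x≈y)
        }
      }

  flagGraph : ColouredGraph n (lsuc p) p
  flagGraph = record
    { vertices    = flags
    ; darts       = flagDarts
    ; init        = source
    ; term        = target
    ; inv         = reverse
    ; colour      = label
    ; init-cong   = λ (_ , s , _) → s
    ; term-cong   = λ (_ , _ , t) → t
    ; inv-cong    = λ (l , s , t) → l , t , s
    ; colour-cong = λ (l , _ , _) → l
    ; inv-inv     = λ d → Setoid.refl flagDarts {d}
    ; init-inv    = λ d → Setoid.refl flags {target d}
    ; term-inv    = λ d → Setoid.refl flags {source d}
    ; colour-inv  = λ _ → ≡.refl
    }

IsFlagGraphOfPolytope : ∀ {n} p → ColouredGraph n c ℓ → Set (c ⊔ ℓ ⊔ lsuc p)
IsFlagGraphOfPolytope {n = n} p G = Σ (Polytope n p) λ P → G ≅ flagGraph P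

{-# OPTIONS --safe #-}
module Submission where

-- A maniplex is a flag graph precisely when flags joined by an I-path and by a J-path
-- are joined by an (I ∩ J)-path.  In a polytope an I-path keeps all faces of rank
-- outside I, and strong connectedness supplies a path keeping all common faces.
-- Conversely, take as faces of rank k the components left after deleting colour k,
-- with incidence meaning intersection.  Since distant colours commute, a path avoiding
-- k can be sorted into colours above k followed by colours below k; this makes incidence
-- transitive and gives every chain a common vertex.  The intersection property says that
-- two vertices sharing a set of faces are joined by a path keeping these faces, which
-- makes flags correspond to vertices and yields the diamond condition and connectedness.
-- Finally, a path from (x , g) to (y , h) in the derived graph is the lift of a path from
-- x to y with voltage h g⁻¹, so the property is the stated condition on voltages.

open import Defs
open import Algebra.Bundles using (Group)
import Algebra.Properties.Group as GroupProperties
open import Axiom.ExcludedMiddle using (ExcludedMiddle)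
open import Data.Fin using (Fin; zero; suc; toℕ; fromℕ; _≟_; _<?_; punchOut)
import Data.Fin.Properties as Fin
open import Data.Fin.Subset using (Subset; _∈_; _∉_; ⊤; ⊥; ⁅_⁆; ⋂) renaming (_∩_ to _∩ˢ_; _⊆_ to _⊆ˢ_)
open import Data.Fin.Subset.Properties using (_∈?_; ∉⊥; x∈⁅x⁆; x∈⁅y⁆⇒x≡y; x∈p∩q⁺; x∈p∩q⁻)
open import Data.List using (List; []; _∷_; map; filter; allFin)
open import Data.List.Membership.Propositional using () renaming (_∈_ to _∈ᴸ_)
open import Data.List.Membership.Propositional.Properties using (∈-filter⁺; ∈-filter⁻; ∈-allFin; ∈-map⁺; ∈-map⁻)
open import Data.List.Relation.Unary.Any using (here; there)
open import Data.Nat using (ℕ; zero; suc; _+_; _∸_; _≤_; _<_; _>_; z≤n; s≤s; ∣_-_∣)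
import Data.Nat.Properties as ℕ
open import Data.Product using (∃; ∃-syntax; ∃!; _×_; _,_; proj₁; proj₂)
open import Data.Sum using (_⊎_; inj₁; inj₂)
open import Data.Vec using (tabulate)
open import Data.Vec.Properties using ([]=⇒lookup; lookup⇒[]=; lookup∘tabulate)
open import Function using (_∘_)
open import Function.Bundles using (Bijection; Equivalence; Inverse; _⇔_; mk⇔)
open import Function.Construct.Composition using (_⇔-∘_)
open import Function.Definitions using (Injective; StrictlySurjective)
open import Level using (Level; _⊔_)
open import Relation.Binary.Bundles using (Poset)
open import Relation.Binary.Definitions using (tri<; tri≈; tri>)
open import Relation.Binary.PropositionalEquality as ≡ using (_≡_; _≢_)
open import Relation.Nullary using (¬_; yes; no; does; ¬?; contradiction; decidable-stable)
open import Relation.Nullary.Decidable using (dec-true)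
open import Relation.Unary using (Pred; Decidable; _⊆_; _∩_; _≐_)
open import Relation.Unary.Properties using (≐-refl; ≐-sym; ≐-trans)

private
  variable
    c ℓ c′ ℓ′ p : Level
    n : ℕ

-- Finite sets, colour sets and shifted ranks.

injective⇒surjective : {f : Fin n → Fin n} → Injective _≡_ _≡_ f → StrictlySurjective _≡_ f
injective⇒surjective {n = suc n} {f} f-injective y with Fin.any? (λ x → f x ≟ y)
... | yes found = found
-- Pigeonhole: punching out the missed `y` would inject `Fin (suc n)` into `Fin n`.
... | no missed = contradiction
      (Fin.injective⇒≤ {f = λ x → punchOut (missed ∘ (x ,_) ∘ ≡.sym)}
        (λ eq → f-injective (Fin.punchOut-injective {i = y} _ (missed ∘ (_ ,_) ∘ ≡.sym) eq)))
      ℕ.1+n≰n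

module _ {P : Pred (Fin n) p} (P? : Decidable P) where

  comprehension : Subset n
  comprehension = tabulate (does ∘ P?)

  ∈-comprehension⁺ : ∀ {i} → P i → i ∈ comprehension
  ∈-comprehension⁺ {i} Pi =
    lookup⇒[]= i _ (≡.trans (lookup∘tabulate (does ∘ P?) i) (dec-true (P? i) Pi))

  ∈-comprehension⁻ : ∀ {i} → i ∈ comprehension → P i
  ∈-comprehension⁻ {i} i∈ with P? i | ≡.trans (≡.sym (lookup∘tabulate (does ∘ P?) i)) ([]=⇒lookup i∈)
  ... | yes Pi | _ = Pi
  ... | no _   | ()

∈-⋂⁻ : ∀ (Is : List (Subset n)) {I i} → i ∈ ⋂ Is → I ∈ᴸ Is → i ∈ I
∈-⋂⁻ (I ∷ Is) i∈ (here ≡.refl) = proj₁ (x∈p∩q⁻ I (⋂ Is) i∈)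
∈-⋂⁻ (I ∷ Is) i∈ (there I∈)    = ∈-⋂⁻ Is (proj₂ (x∈p∩q⁻ I (⋂ Is) i∈)) I∈

toℕ-properRank : (i : Fin n) → toℕ (properRank i) ≡ suc (toℕ i)
toℕ-properRank i = ≡.cong suc (Fin.toℕ-inject₁ i)

-- No colour has rank `zero` or `fromℕ (suc n)`, so `off` is full at the improper ranks and the
-- whole connected graph serves both as least and as greatest face.
off above below : Fin (2 + n) → Subset n
off   k = comprehension (λ i → ¬? (properRank i ≟ k))
above k = comprehension (λ i → k <? properRank i)
below k = comprehension (λ i → properRank i <? k)

∈-off⁺ : ∀ {k} {i : Fin n} → properRank i ≢ k → i ∈ off k
∈-off⁺ {k = k} = ∈-comprehension⁺ (λ i → ¬? (properRank i ≟ k))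

∈-off⁻ : ∀ {k} {i : Fin n} → i ∈ off k → properRank i ≢ k
∈-off⁻ {k = k} = ∈-comprehension⁻ (λ i → ¬? (properRank i ≟ k))

∈-above⁻ : ∀ {k} {i : Fin n} → i ∈ above k → toℕ k < toℕ (properRank i)
∈-above⁻ {k = k} = ∈-comprehension⁻ (λ i → k <? properRank i)

∈-below⁻ : ∀ {k} {i : Fin n} → i ∈ below k → toℕ (properRank i) < toℕ k
∈-below⁻ {k = k} = ∈-comprehension⁻ (λ i → properRank i <? k)

off⇒above⊎below : ∀ k {i : Fin n} → i ∈ off k → i ∈ above k ⊎ i ∈ below k
off⇒above⊎below k {i} i∈ with Fin.<-cmp k (properRank i)
... | tri< k<i _ _ = inj₁ (∈-comprehension⁺ (λ i → k <? properRank i) k<i)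
... | tri≈ _ k≡i _ = contradiction (≡.sym k≡i) (∈-off⁻ i∈)
... | tri> _ _ i<k = inj₂ (∈-comprehension⁺ (λ i → properRank i <? k) i<k)

-- Hence a path in colours above `k` keeps every face of rank up to `k`; `below⊆off` is the dual.
above⊆off : ∀ {k l : Fin (2 + n)} → toℕ l ≤ toℕ k → above k ⊆ˢ off l
above⊆off l≤k i∈ = ∈-off⁺ λ i≡l →
  ℕ.<-irrefl ≡.refl (ℕ.<-≤-trans (∈-above⁻ i∈) (ℕ.≤-trans (ℕ.≤-reflexive (≡.cong toℕ i≡l)) l≤k))

below⊆off : ∀ {k l : Fin (2 + n)} → toℕ k ≤ toℕ l → below k ⊆ˢ off l
below⊆off k≤l i∈ = ∈-off⁺ λ i≡l →
  ℕ.<-irrefl ≡.refl (ℕ.<-≤-trans (∈-below⁻ i∈) (ℕ.≤-trans k≤l (ℕ.≤-reflexive (≡.cong toℕ (≡.sym i≡l)))))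

Distant : Subset n → Subset n → Set
Distant A B = ∀ {i j} → i ∈ A → j ∈ B → ∣ toℕ i - toℕ j ∣ > 1

-- The colour of rank `k` lies strictly between, so the two colours differ by at least two.
above-below-distant : (k : Fin (2 + n)) → Distant (above k) (below k)
above-below-distant k {i} {j} i∈ j∈ = ℕ.≤-trans 2≤i∸j (ℕ.m∸n≤∣m-n∣ (toℕ i) (toℕ j))
  where
  2+j≤i : 2 + toℕ j ≤ toℕ i
  2+j≤i = ℕ.≤-pred (ℕ.≤-trans
    (s≤s (≡.subst (_< toℕ k) (toℕ-properRank j) (∈-below⁻ {k = k} j∈)))
    (≡.subst (toℕ k <_) (toℕ-properRank i) (∈-above⁻ {k = k} i∈)))
  2≤i∸j : 2 ≤ toℕ i ∸ toℕ j
  2≤i∸j = ℕ.m+n≤o⇒m≤o∸n 2 2+j≤i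

off-least : {i : Fin n} → i ∈ off zero
off-least {n} = ∈-off⁺ {k = zero} λ ()

off-greatest : {i : Fin n} → i ∈ off (fromℕ (suc n))
off-greatest {n} = ∈-off⁺ {k = fromℕ (suc n)} λ eq → Fin.fromℕ≢inject₁ (≡.sym (Fin.suc-injective eq))

-- Paths with restricted colours.

module _ (G : ColouredGraph n c ℓ) where

  open ColouredGraph G

  PathIntersection : Set (c ⊔ ℓ)
  PathIntersection = ∀ I J {u v} → Path I u v → Path J u v → Path (I ∩ˢ J) u v

module Paths (G : ColouredGraph n c ℓ) where

  open ColouredGraph G

  private
    variable
      I J : Subset n
      u v w : Vertex

  castˡ : u ≈ᵥ v → Path I v w → Path I u w
  castˡ u≈v (nil v≈w)        = nil (≈ᵥ-trans u≈v v≈w)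
  castˡ u≈v (cons d eq i∈ q) = cons d (≈ᵥ-trans eq (≈ᵥ-sym u≈v)) i∈ q

  infixr 5 _++_

  _++_ : Path I u v → Path I v w → Path I u w
  nil u≈v        ++ q = castˡ u≈v q
  cons d eq i∈ p ++ q = cons d eq i∈ (p ++ q)

  edge : ∀ d → colour d ∈ I → Path I (init d) (term d)
  edge d i∈ = cons d ≈ᵥ-refl i∈ (nil ≈ᵥ-refl)

  reverse : Path I u v → Path I v u
  reverse (nil u≈v)        = nil (≈ᵥ-sym u≈v)
  reverse {I = I} (cons d eq i∈ p) = reverse p ++
    cons (inv d) (init-inv d) (≡.subst (_∈ I) (≡.sym (colour-inv d)) i∈)
      (nil (≈ᵥ-trans (term-inv d) eq))

  weaken : I ⊆ˢ J → Path I u v → Path J u v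
  weaken I⊆J (nil u≈v)        = nil u≈v
  weaken I⊆J (cons d eq i∈ p) = cons d eq (I⊆J i∈) (weaken I⊆J p)

  empty-path : (∀ i → i ∉ I) → Path I u v → u ≈ᵥ v
  empty-path none (nil u≈v)       = u≈v
  empty-path none (cons d _ i∈ _) = contradiction i∈ (none (colour d))

  module _ (intersection : PathIntersection G) where

    path-⋂ : ∀ Is → Path ⊤ u v → (∀ {I} → I ∈ᴸ Is → Path I u v) → Path (⋂ Is) u v
    path-⋂ []       p ps = p
    path-⋂ (I ∷ Is) p ps = intersection I (⋂ Is) (ps (here ≡.refl)) (path-⋂ Is p (ps ∘ there))

    -- The colours excluded one at a time leave only `S`, so iterating the binary intersection
    -- property suffices. The path over `⊤` covers the empty intersection.
    path-within : ∀ S → Path ⊤ u v → (∀ i → i ∉ S → Path (off (properRank i)) u v) → Path S u v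
    path-within S p ps = weaken avoid (path-⋂ Is p ps′)
      where
      outside : List (Fin _)
      outside = filter (λ i → ¬? (i ∈? S)) (allFin _)
      Is : List (Subset _)
      Is = map (off ∘ properRank) outside
      ps′ : ∀ {I} → I ∈ᴸ Is → Path I _ _
      ps′ I∈ with ∈-map⁻ (off ∘ properRank) I∈
      ... | i , i∈ , ≡.refl = ps i (proj₂ (∈-filter⁻ (λ i → ¬? (i ∈? S)) {xs = allFin _} i∈))
      avoid : ⋂ Is ⊆ˢ S
      avoid {i} i∈ = decidable-stable (i ∈? S) λ i∉S →
        ∈-off⁻ (∈-⋂⁻ Is i∈ (∈-map⁺ (off ∘ properRank)
          (∈-filter⁺ (λ i → ¬? (i ∈? S)) (∈-allFin i) i∉S))) ≡.refl

-- From a polytope to the intersection property.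

module _ (G : ColouredGraph n c ℓ) (P : Polytope n p) (iso : G ≅ flagGraph P) where

  open ColouredGraph G
  open Paths G
  open Polytope P
  open Poset poset using (Carrier; module Eq) renaming (_≈_ to _≈ₚ_; _≤_ to _≤ₚ_)
  open _≅_ iso
  open Inverse onVertices using () renaming
    (to to flagAt; from to vertexAt; to-cong to flagAt-cong; from-cong to vertexAt-cong; strictlyInverseʳ to vertexAt-flagAt)
  open Inverse onDarts using () renaming (to to flagDart; from to dartAt; strictlyInverseˡ to flagDart-dartAt)

  -- Faces of a flag are comparable and rank is strictly monotone, so rank is injective on its
  -- `2 + n` faces and hence attains each of the `2 + n` values.
  face-of-rank : ∀ (Φ : Flag poset) r → ∃[ x ] (subset Φ x × rank x ≡ r)
  face-of-rank Φ r =
    let k , rank≡r = injective⇒surjective injective r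
    in proj₁ (face k) , proj₂ (face k) , rank≡r
    where
    module B = Bijection (IsFlagged.cardinality isFlagged Φ)
    face = B.to
    strict : ∀ {x y} → x ≤ₚ y → ¬ x ≈ₚ y → rank x ≢ rank y
    strict x≤y x≉y eq = ℕ.<-irrefl (≡.cong toℕ eq) (rank-mono (x≤y , x≉y))
    injective : Injective _≡_ _≡_ (λ k → rank (proj₁ (face k)))
    -- Equality of faces is not decidable, but equality of their indices is, which permits arguing
    -- by contradiction.
    injective {k} {l} eq = decidable-stable (k ≟ l) λ k≢l →
      not-apart (k≢l ∘ B.injective)
      where
      not-apart : ¬ ¬ (proj₁ (face k) ≈ₚ proj₁ (face l))
      not-apart x≉y with IsChain.comparable (Flag.isChain Φ) (proj₂ (face k)) (proj₂ (face l))
      ... | inj₁ x≤y = strict x≤y x≉y eq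
      ... | inj₂ y≤x = strict y≤x (x≉y ∘ Eq.sym) (≡.sym eq)

  -- An edge of colour `i` changes only the face of rank `properRank i`.
  keeps-face : ∀ {I u v x} → Path I u v → (∀ {i} → i ∈ I → rank x ≢ properRank i) →
               subset (flagAt u) x → subset (flagAt v) x
  keeps-face (nil u≈v) avoid x∈ = proj₁ (flagAt-cong u≈v) x∈
  keeps-face {x = x} (cons d eq i∈ p) avoid x∈ =
    keeps-face p avoid (proj₁ (preserves-term d) (Equivalence.to (agree x (avoid label∈))
      (proj₂ (preserves-init d) (proj₂ (flagAt-cong eq) x∈))))
    where
    open FlagDart (flagDart d)
    open Adjacent adjacent
    label∈ = ≡.subst (_∈ _) (≡.sym (preserves-colour d)) i∈

  sequence-start : ∀ {S Φ Ψ} → FlagSequence poset rank S Φ Ψ → S ⊆ subset Φ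
  sequence-start (stop S⊆ _)     = S⊆
  sequence-start (step S⊆ _ _ _) = S⊆

  sequence⇒path : ∀ {S K Φ Ψ} → (∀ i → i ∉ K → ∃[ x ] (S x × rank x ≡ properRank i)) →
                  FlagSequence poset rank S Φ Ψ → Path K (vertexAt Φ) (vertexAt Ψ)
  sequence⇒path kept (stop _ Φ≐Ψ) = nil (vertexAt-cong Φ≐Ψ)
  sequence⇒path {K = K} {Φ = Φ} kept (step {Χ = Χ} S⊆ i adj seq) =
    cons d init≈ i∈ (castˡ term≈ (sequence⇒path kept seq))
    where
    e : FlagDart P
    e = record { source = Φ ; target = Χ ; label = i ; adjacent = adj }
    d : Dart
    d = dartAt e
    label≡ = proj₁ (flagDart-dartAt e)
    init≈ : init d ≈ᵥ vertexAt Φ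
    init≈ = ≈ᵥ-trans (≈ᵥ-sym (vertexAt-flagAt (init d)))
      (vertexAt-cong (≐-trans (≐-sym (preserves-init d)) (proj₁ (proj₂ (flagDart-dartAt e)))))
    term≈ : term d ≈ᵥ vertexAt Χ
    term≈ = ≈ᵥ-trans (≈ᵥ-sym (vertexAt-flagAt (term d)))
      (vertexAt-cong (≐-trans (≐-sym (preserves-term d)) (proj₂ (proj₂ (flagDart-dartAt e)))))
    i∈K : i ∈ K
    -- A step of colour outside `K` would replace a face lying in `S`, yet `S` is contained in the
    -- flags on both sides of the step.
    i∈K = decidable-stable (i ∈? K) λ i∉K →
      let x , x∈S , r = kept i i∉K
      in Adjacent.differ adj x x r r (S⊆ x∈S) (sequence-start seq x∈S) Eq.refl
    i∈ : colour d ∈ K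
    i∈ = ≡.subst (_∈ K) (≡.trans (≡.sym label≡) (preserves-colour d)) i∈K

  flagGraph⇒intersection : PathIntersection G
  flagGraph⇒intersection I J {u} {v} p q =
    castˡ (≈ᵥ-sym (vertexAt-flagAt u))
      (sequence⇒path kept (stronglyFlagConnected (flagAt u) (flagAt v)) ++ nil (vertexAt-flagAt v))
    where
    ∉⇒≢ : ∀ {K i x} → i ∉ K → rank x ≡ properRank i → ∀ {j} → j ∈ K → rank x ≢ properRank j
    ∉⇒≢ i∉ r j∈ s = i∉ (≡.subst (_∈ _)
      (Fin.inject₁-injective (Fin.suc-injective (≡.trans (≡.sym s) r))) j∈)
    -- A colour outside `I ∩ˢ J` is missed by `p` or by `q`, and that path carries the face of this
    -- rank from one flag to the other.
    kept : ∀ i → i ∉ I ∩ˢ J → ∃[ x ] ((subset (flagAt u) ∩ subset (flagAt v)) x × rank x ≡ properRank i)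
    kept i i∉ with face-of-rank (flagAt u) (properRank i) | i ∈? I | i ∈? J
    ... | x , x∈ , r | yes i∈I | yes i∈J = contradiction (x∈p∩q⁺ (i∈I , i∈J)) i∉
    ... | x , x∈ , r | no i∉I  | _       = x , (x∈ , keeps-face p (∉⇒≢ i∉I r) x∈) , r
    ... | x , x∈ , r | yes _   | no i∉J  = x , (x∈ , keeps-face q (∉⇒≢ i∉J r) x∈) , r

-- Local structure of a maniplex and sorting of paths.

module Maniplex (G : ColouredGraph n c ℓ) (M : ColouredGraph.IsManiplex G) where

  open ColouredGraph G
  open Paths G
  open IsManiplex M
  open IsSimple simple

  -- Properness gives the same edge; the opposite orientation would make that edge a loop.
  dart-unique : ∀ {d e} → init d ≈ᵥ init e → colour d ≡ colour e → d ≈ₑ e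
  dart-unique {d} {e} init≈ colour≡
    with proper (init d) d e (inj₁ ≈ᵥ-refl) (inj₁ (≈ᵥ-sym init≈)) colour≡
  ... | inj₁ e≈d    = ≈ₑ-sym e≈d
  ... | inj₂ e≈invd = contradiction
        (≈ᵥ-trans init≈ (≈ᵥ-trans (init-cong e≈invd) (init-inv d))) (allLinks d)

  fork-colours : ∀ {d e} → init d ≈ᵥ init e → ¬ term d ≈ᵥ term e → colour d ≢ colour e
  fork-colours init≈ term≉ colour≡ = term≉ (term-cong (dart-unique init≈ colour≡))

  -- The `n` darts leaving `v` have distinct colours, so every one of the `n` colours occurs.
  dart-of-colour : ∀ v i → ∃[ d ] (init d ≈ᵥ v × colour d ≡ i)
  dart-of-colour v i =
    let k , colour≡i = injective⇒surjective colour-injective i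
    in proj₁ (B.to k) , proj₂ (B.to k) , colour≡i
    where
    module B = Bijection (regular v)
    colour-injective : Injective _≡_ _≡_ (λ k → colour (proj₁ (B.to k)))
    colour-injective {k} {l} eq = B.injective
      (dart-unique (≈ᵥ-trans (proj₂ (B.to k)) (≈ᵥ-sym (proj₂ (B.to l)))) eq)

  -- A component in one colour is a single edge. After the first dart `e` the induction proceeds
  -- with `inv e`, so the two alternatives swap.
  path-single : ∀ {i u v d} → init d ≈ᵥ u → colour d ≡ i → Path ⁅ i ⁆ u v → v ≈ᵥ u ⊎ v ≈ᵥ term d
  path-single init≈ colour≡ (nil u≈v) = inj₁ (≈ᵥ-sym u≈v)
  path-single {i} {d = d} init≈ colour≡ (cons e eq e∈ p)
    with path-single {d = inv e} (init-inv e) (≡.trans (colour-inv e) (x∈⁅y⁆⇒x≡y i e∈)) p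
  ... | inj₁ v≈ = inj₂ (≈ᵥ-trans v≈ (term-cong
                    (dart-unique (≈ᵥ-trans eq (≈ᵥ-sym init≈)) (≡.trans (x∈⁅y⁆⇒x≡y i e∈) (≡.sym colour≡)))))
  ... | inj₂ v≈ = inj₁ (≈ᵥ-trans v≈ (≈ᵥ-trans (term-inv e) eq))

  -- The other way round the square spanned by `d` followed by `e`, with the two colours in the
  -- opposite order.
  record Detour (d e : Dart) : Set (c ⊔ ℓ) where
    field
      e′ d′  : Dart
      start  : init e′ ≈ᵥ init d
      middle : term e′ ≈ᵥ init d′
      end    : term d′ ≈ᵥ term e
      e′≡e   : colour e′ ≡ colour e
      d′≡d   : colour d′ ≡ colour d

  alternate : ∀ {i j x y : Fin n} → x ≡ i ⊎ x ≡ j → y ≡ i ⊎ y ≡ j → x ≢ y →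
              (x ≡ i × y ≡ j) ⊎ (x ≡ j × y ≡ i)
  alternate (inj₁ ≡.refl) (inj₁ ≡.refl) x≢y = contradiction ≡.refl x≢y
  alternate (inj₁ x≡i) (inj₂ y≡j) _ = inj₁ (x≡i , y≡j)
  alternate (inj₂ x≡j) (inj₁ y≡i) _ = inj₂ (x≡j , y≡i)
  alternate (inj₂ ≡.refl) (inj₂ ≡.refl) x≢y = contradiction ≡.refl x≢y

  detour : ∀ {d e} → ∣ toℕ (colour d) - toℕ (colour e) ∣ > 1 → term d ≈ᵥ init e → Detour d e
  detour {d} {e} far joined = result
    where
    open FourCycleComponent (squares (colour d) (colour e) far (init d))

    -- Here `f`, `g` is the half of the 4-cycle coloured like `d`, `e`; by `dart-unique` it ends
    -- where `e` ends. The other half `g′`, `f′` is the detour.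
    follow : ∀ {f g f′ g′} → init f ≈ᵥ init d → term f ≈ᵥ init g →
             colour f ≡ colour d → colour g ≡ colour e →
             init g′ ≈ᵥ init d → term g′ ≈ᵥ init f′ → term f′ ≈ᵥ term g →
             colour g′ ≡ colour e → colour f′ ≡ colour d → Detour d e
    follow f-start f-g f≡ g≡ g′-start g′-f′ f′-end g′≡ f′≡ = record
      { start  = g′-start
      ; middle = g′-f′
      ; end    = ≈ᵥ-trans f′-end (term-cong (dart-unique
                   (≈ᵥ-trans (≈ᵥ-sym f-g) (≈ᵥ-trans (term-cong (dart-unique f-start f≡)) joined)) g≡))
      ; e′≡e   = g′≡
      ; d′≡d   = f′≡
      }

    opposite : init (inv d₃) ≈ᵥ init d
    opposite = ≈ᵥ-trans (init-inv d₃) (≈ᵥ-trans join₃ start)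
    opposite-join : term (inv d₃) ≈ᵥ init (inv d₂)
    opposite-join = ≈ᵥ-trans (term-inv d₃) (≈ᵥ-trans (≈ᵥ-sym join₂) (≈ᵥ-sym (init-inv d₂)))
    meet : term (inv d₂) ≈ᵥ term d₁
    meet = ≈ᵥ-trans (term-inv d₂) (≈ᵥ-sym join₁)

    -- Consecutive sides differ in colour: equally coloured darts leaving a common corner would end
    -- together and identify two distinct corners.
    colour₀≢₁ : colour d₀ ≢ colour d₁
    colour₀≢₁ eq = fork-colours {inv d₀} {d₁} (≈ᵥ-trans (init-inv d₀) join₀)
      (λ t → distinct₀₂ (≈ᵥ-trans (≈ᵥ-sym (term-inv d₀)) (≈ᵥ-trans t join₁)))
      (≡.trans (colour-inv d₀) eq)
    colour₃≢₂ : colour d₃ ≢ colour d₂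
    colour₃≢₂ eq = fork-colours {inv d₂} {d₃} (≈ᵥ-trans (init-inv d₂) join₂)
      (λ t → distinct₀₂ (≈ᵥ-sym (≈ᵥ-trans (≈ᵥ-sym (term-inv d₂)) (≈ᵥ-trans t join₃))))
      (≡.trans (colour-inv d₂) (≡.sym eq))
    colour₀≢₃ : colour d₀ ≢ colour d₃
    colour₀≢₃ eq = fork-colours {d₀} {inv d₃} (≈ᵥ-trans start (≈ᵥ-sym opposite))
      (λ t → distinct₁₃ (≈ᵥ-trans (≈ᵥ-sym join₀) (≈ᵥ-trans t (term-inv d₃))))
      (≡.trans eq (≡.sym (colour-inv d₃)))

    result : Detour d e
    result with alternate (coloured d₀ (inj₁ (inj₁ ≈ₑ-refl)))
                          (coloured d₁ (inj₂ (inj₁ (inj₁ ≈ₑ-refl)))) colour₀≢₁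
              | alternate (coloured d₃ (inj₂ (inj₂ (inj₂ (inj₁ ≈ₑ-refl)))))
                          (coloured d₂ (inj₂ (inj₂ (inj₁ (inj₁ ≈ₑ-refl))))) colour₃≢₂
    ... | inj₁ (c₀ , _)  | inj₁ (c₃ , _)  = contradiction (≡.trans c₀ (≡.sym c₃)) colour₀≢₃
    ... | inj₂ (c₀ , _)  | inj₂ (c₃ , _)  = contradiction (≡.trans c₀ (≡.sym c₃)) colour₀≢₃
    ... | inj₁ (c₀ , c₁) | inj₂ (c₃ , c₂) =
      follow start join₀ c₀ c₁ opposite opposite-join meet
        (≡.trans (colour-inv d₃) c₃) (≡.trans (colour-inv d₂) c₂)
    ... | inj₂ (c₀ , c₁) | inj₁ (c₃ , c₂) =
      follow opposite opposite-join (≡.trans (colour-inv d₃) c₃) (≡.trans (colour-inv d₂) c₂)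
        start join₀ (≈ᵥ-sym meet) c₀ c₁

  module _ {A B : Subset n} (distant : Distant A B) where

    -- Each detour exchanges the dart with the next dart of the path, until the dart stands last.
    push : ∀ {d u v} → colour d ∈ B → term d ≈ᵥ u → Path A u v →
           ∃[ m ] (Path A (init d) m × Path B m v)
    push {d} d∈ eq (nil u≈v) = init d , nil ≈ᵥ-refl , cons d ≈ᵥ-refl d∈ (nil (≈ᵥ-trans eq u≈v))
    push {d} d∈ eq (cons e e-init e∈ p) =
      let m , q , r = push (≡.subst (_∈ B) (≡.sym d′≡d) d∈) end p
      in m , cons e′ start (≡.subst (_∈ A) (≡.sym e′≡e) e∈) (castˡ middle q) , r
      where
      open Detour (detour {d} {e}
        (≡.subst (_> 1) (ℕ.∣-∣-comm (toℕ (colour e)) (toℕ (colour d))) (distant e∈ d∈))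
        (≈ᵥ-trans eq (≈ᵥ-sym e-init)))

    -- Insertion sort: the tail is sorted first, and a leading dart with colour in `B` is pushed
    -- past its `A`-part.
    sort-path : ∀ {I u v} → (∀ {i} → i ∈ I → i ∈ A ⊎ i ∈ B) → Path I u v →
                ∃[ m ] (Path A u m × Path B m v)
    sort-path split (nil u≈v) = _ , nil u≈v , nil ≈ᵥ-refl
    sort-path split (cons d eq i∈ p) with sort-path split p | split i∈
    ... | m , q , r | inj₁ ∈A = m , cons d eq ∈A q , r
    ... | m , q , r | inj₂ ∈B =
      let m′ , q′ , s = push {d} ∈B ≈ᵥ-refl q
      in m′ , castˡ (≈ᵥ-sym eq) q′ , s ++ r

  -- The poset of faces and the flag of a vertex.

  infix 4 _~[_]_
  _~[_]_ : Vertex → Fin (2 + n) → Vertex → Set (c ⊔ ℓ)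
  u ~[ k ] v = Path (off k) u v

  ~-sort : ∀ k {u v} → u ~[ k ] v → ∃[ m ] (Path (above k) u m × Path (below k) m v)
  ~-sort k = sort-path (above-below-distant k) (off⇒above⊎below k)

  ~-least : ∀ {u v} → u ~[ zero ] v
  ~-least = weaken (λ _ → off-least) (proj₂ connected _ _)

  ~-greatest : ∀ {u v} → u ~[ fromℕ (suc n) ] v
  ~-greatest = weaken (λ _ → off-greatest) (proj₂ connected _ _)

  -- A face of rank k is a component of the graph without colour k, represented
  -- by a vertex; ranks are shifted by one, as in `Polytope`.
  record Face : Set (c ⊔ ℓ) where
    constructor face
    field
      rank   : Fin (2 + n)
      vertex : Vertex

  open Face public

  infix 4 _≈ᶠ_ _≤ᶠ_
  _≈ᶠ_ _≤ᶠ_ : Face → Face → Set (c ⊔ ℓ)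
  F ≈ᶠ H = rank F ≡ rank H × vertex F ~[ rank F ] vertex H
  F ≤ᶠ H = toℕ (rank F) ≤ toℕ (rank H) × ∃[ u ] (u ~[ rank F ] vertex F × u ~[ rank H ] vertex H)

  ≤ᶠ-reflexive : ∀ {F H} → F ≈ᶠ H → F ≤ᶠ H
  ≤ᶠ-reflexive {F} {H} (≡.refl , p) = ℕ.≤-refl , vertex F , nil ≈ᵥ-refl , p

  ≤ᶠ-trans : ∀ {F H K} → F ≤ᶠ H → H ≤ᶠ K → F ≤ᶠ K
  ≤ᶠ-trans {F} {H} {K} (F≤H , u , u~F , u~H) (H≤K , w , w~H , w~K) =
    -- The turning point `m` of the sorted path from `u` to `w` lies in all three faces: colours
    -- above `rank H` keep `F`, colours below keep `K`.
    let m , p , q = ~-sort (rank H) (u~H ++ reverse w~H)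
    in ℕ.≤-trans F≤H H≤K , m , reverse (weaken (above⊆off F≤H) p) ++ u~F
                             , weaken (below⊆off H≤K) q ++ w~K

  -- Components of the same subgraph that meet coincide.
  ≤ᶠ-same-rank : ∀ {F H} → rank F ≡ rank H → F ≤ᶠ H ⊎ H ≤ᶠ F → vertex F ~[ rank F ] vertex H
  ≤ᶠ-same-rank {face k v} {face .k w} ≡.refl (inj₁ (_ , u , u~v , u~w)) = reverse u~v ++ u~w
  ≤ᶠ-same-rank {face k v} {face .k w} ≡.refl (inj₂ (_ , u , u~w , u~v)) = reverse u~v ++ u~w

  facePoset : Poset (c ⊔ ℓ) (c ⊔ ℓ) (c ⊔ ℓ)
  facePoset = record
    { Carrier = Face
    ; _≈_ = _≈ᶠ_
    ; _≤_ = _≤ᶠ_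
    ; isPartialOrder = record
      { isPreorder = record
        { isEquivalence = record
          { refl  = ≡.refl , nil ≈ᵥ-refl
          ; sym   = λ { (≡.refl , p) → ≡.refl , reverse p }
          ; trans = λ { (≡.refl , p) (≡.refl , q) → ≡.refl , p ++ q }
          }
        ; reflexive = ≤ᶠ-reflexive
        ; trans = ≤ᶠ-trans
        }
      ; antisym = λ F≤H H≤F →
          let eq = Fin.toℕ-injective (ℕ.≤-antisym (proj₁ F≤H) (proj₁ H≤F))
          in eq , ≤ᶠ-same-rank eq (inj₁ F≤H)
      }
    }

  flagOf : Vertex → Flag facePoset
  flagOf u = record
    { subset  = λ F → u ~[ rank F ] vertex F
    ; isChain = record
      { respects   = λ { (≡.refl , p) u~F → u~F ++ p }
      ; comparable = comparable
      }
    -- A face of a larger chain is comparable to the face of the same rank through `u`, hence equal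
    -- to it.
    ; maximal = λ D chain ⊆D {F} F∈D →
        ≤ᶠ-same-rank {face (rank F) u} ≡.refl
          (IsChain.comparable chain (⊆D {face (rank F) u} (nil ≈ᵥ-refl)) F∈D)
    }
    where
    comparable : ∀ {F H} → u ~[ rank F ] vertex F → u ~[ rank H ] vertex H → F ≤ᶠ H ⊎ H ≤ᶠ F
    comparable {F} {H} u~F u~H with ℕ.≤-total (toℕ (rank F)) (toℕ (rank H))
    ... | inj₁ F≤H = inj₁ (F≤H , u , u~F , u~H)
    ... | inj₂ H≤F = inj₂ (H≤F , u , u~H , u~F)

  flagOf-cong : ∀ {u v} → u ≈ᵥ v → _≐ᶠ_ facePoset (flagOf u) (flagOf v)
  flagOf-cong u≈v = castˡ (≈ᵥ-sym u≈v) , castˡ u≈v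

  flagOf-path : ∀ {u v} → _≐ᶠ_ facePoset (flagOf u) (flagOf v) → ∀ k → u ~[ k ] v
  flagOf-path {v = v} (_ , ⊇) k = ⊇ {face k v} (nil ≈ᵥ-refl)

  -- Every flag of the face poset comes from a vertex.

  module Classical (em : ExcludedMiddle (c ⊔ ℓ)) where

    module _ {C : Pred Face (c ⊔ ℓ)} (chain : IsChain facePoset C) where

      open IsChain chain

      -- The faces of rank at most m in the chain share the vertex `common`.  Face
      -- `top` through it stands for the largest of them (for the least face if
      -- there is none), and is therefore comparable to the whole chain.
      record Gathered (m : ℕ) : Set (c ⊔ ℓ) where
        field
          common  : Vertex
          top     : Fin (2 + n)
          top≤m   : toℕ top ≤ m
          covers  : ∀ F → C F → toℕ (rank F) ≤ m →
                    toℕ (rank F) ≤ toℕ top × common ~[ rank F ] vertex F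
          top-comparable : ∀ F → C F → face top common ≤ᶠ F ⊎ F ≤ᶠ face top common

      gather : ∀ m → Gathered m
      -- At level 0 only the least face can occur; it contains every vertex, so any vertex serves.
      gather zero = record
        { common = proj₁ connected
        ; top    = zero
        ; top≤m  = z≤n
        ; covers = λ { (face zero v) _ _ → z≤n , ~-least ; (face (suc _) _) _ () }
        ; top-comparable = λ F _ → inj₁ (z≤n , vertex F , ~-least , nil ≈ᵥ-refl)
        }
      gather (suc m) with gather m | em {∃[ F ] (C F × toℕ (rank F) ≡ suc m)}
      ... | g | no ∄F = record
        { common = common
        ; top    = top
        ; top≤m  = ℕ.m≤n⇒m≤1+n top≤m
        ; covers = λ F F∈ F≤1+m → covers F F∈
            (ℕ.≤-pred (ℕ.≤∧≢⇒< F≤1+m λ eq → ∄F (F , F∈ , eq)))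
        ; top-comparable = top-comparable
        }
        where open Gathered g
      ... | g | yes (F , F∈ , F≡1+m) with Gathered.top-comparable g F F∈
      -- Impossible, as `F` has rank `suc m` while `top` is at most `m`.
      ... | inj₂ (F≤top , _) = contradiction
            (ℕ.≤-trans (ℕ.≤-reflexive (≡.sym F≡1+m)) (ℕ.≤-trans F≤top (Gathered.top≤m g))) ℕ.1+n≰n
      -- The vertex `x` lies in the top face and in `F`. Sorting the path from `common` to `x` at
      -- rank `top` gives a turning point `u`: the part above `top` keeps the faces gathered so far,
      -- and the part below stays within `F`.
      ... | inj₁ (top≤F , x , x~top , x~F) with ~-sort (Gathered.top g) (reverse x~top)
      ... | u , p , q = record
        { common = u
        ; top    = rank F
        ; top≤m  = ℕ.≤-reflexive F≡1+m
        ; covers = covers′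
        ; top-comparable = λ H H∈ → transport (comparable F∈ H∈)
        }
        where
        open Gathered g
        u~F : u ~[ rank F ] vertex F
        u~F = weaken (below⊆off top≤F) q ++ x~F
        covers′ : ∀ H → C H → toℕ (rank H) ≤ suc m →
                  toℕ (rank H) ≤ toℕ (rank F) × u ~[ rank H ] vertex H
        covers′ H H∈ H≤1+m with ℕ.m≤n⇒m<n∨m≡n H≤1+m
        ... | inj₁ H≤m =
          let H≤top , common~H = covers H H∈ (ℕ.≤-pred H≤m)
          in ℕ.≤-trans H≤top top≤F , reverse (weaken (above⊆off H≤top) p) ++ common~H
        ... | inj₂ H≡1+m with Fin.toℕ-injective (≡.trans F≡1+m (≡.sym H≡1+m))
        ... | F≡H = ℕ.≤-reflexive (≡.cong toℕ (≡.sym F≡H)) ,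
          ≡.subst (u ~[_] vertex H) F≡H (u~F ++ ≤ᶠ-same-rank F≡H (comparable F∈ H∈))
        transport : ∀ {H} → F ≤ᶠ H ⊎ H ≤ᶠ F → face (rank F) u ≤ᶠ H ⊎ H ≤ᶠ face (rank F) u
        transport {H} (inj₁ F≤H) = inj₁ (≤ᶠ-trans {H = F} (≤ᶠ-reflexive (≡.refl , u~F)) F≤H)
        transport {H} (inj₂ H≤F) = inj₂ (≤ᶠ-trans {H = F} H≤F (≤ᶠ-reflexive (≡.refl , reverse u~F)))

      chain-vertex : ∃[ u ] (C ⊆ subset (flagOf u))
      chain-vertex = common , λ {F} F∈ → proj₂ (covers F F∈ (Fin.toℕ≤pred[n] (rank F)))
        where open Gathered (gather (suc n))

    vertexOf : Flag facePoset → Vertex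
    vertexOf Φ = proj₁ (chain-vertex (Flag.isChain Φ))

    -- The flag of the common vertex is a chain containing `Φ`, so maximality of `Φ` makes them
    -- equal.
    flagOf-vertexOf : ∀ Φ → _≐ᶠ_ facePoset (flagOf (vertexOf Φ)) Φ
    flagOf-vertexOf Φ = Flag.maximal Φ _ (Flag.isChain (flagOf (vertexOf Φ))) Φ⊆ , Φ⊆
      where Φ⊆ = proj₂ (chain-vertex (Flag.isChain Φ))

    isFlagged : IsFlagged facePoset n
    isFlagged = record
      { least       = face zero (proj₁ connected) ,
                      λ F → z≤n , vertex F , ~-least , nil ≈ᵥ-refl
      ; greatest    = face (fromℕ (suc n)) (proj₁ connected) ,
                      λ F → Fin.≤fromℕ (rank F) , vertex F , nil ≈ᵥ-refl , ~-greatest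
      -- Exactly one face of each rank passes through a vertex, so ranks enumerate the flag.
      ; cardinality = λ Φ → record
        { to        = λ k → face k (vertexOf Φ) , proj₁ (flagOf-vertexOf Φ) (nil ≈ᵥ-refl)
        ; cong      = λ { ≡.refl → ≡.refl , nil ≈ᵥ-refl }
        ; bijective = proj₁ ,
                      λ (F , F∈) → rank F , λ { ≡.refl → ≡.refl , proj₂ (flagOf-vertexOf Φ) F∈ }
        }
      }

    -- The polytope obtained from the intersection property.

    module _ (intersection : PathIntersection G) where

      private
        infix 4 _≐ꟳ_
        _≐ꟳ_ : Flag facePoset → Flag facePoset → Set (c ⊔ ℓ)
        _≐ꟳ_ = _≐ᶠ_ facePoset

      -- Vertices sharing all faces are joined by a path with no colours at all, which is empty.
      flagOf-injective : ∀ {u v} → flagOf u ≐ꟳ flagOf v → u ≈ᵥ v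
      flagOf-injective {u} {v} eq = empty-path (λ _ → ∉⊥)
        (path-within intersection ⊥ (proj₂ connected u v)
          (λ i _ → flagOf-path eq (properRank i)))

      -- Otherwise the ends of `d` would be joined both by its colour alone and by a path avoiding
      -- it, hence by an empty path, although `d` is a link.
      ends-separated : ∀ d → ¬ init d ~[ properRank (colour d) ] term d
      ends-separated d p = allLinks d (empty-path empty
        (intersection ⁅ colour d ⁆ (off (properRank (colour d))) (edge d (x∈⁅x⁆ (colour d))) p))
        where
        empty : ∀ i → i ∉ ⁅ colour d ⁆ ∩ˢ off (properRank (colour d))
        empty i i∈ with x∈p∩q⁻ _ _ i∈
        ... | ∈₁ , ∈₂ = ∈-off⁻ ∈₂ (≡.cong properRank (x∈⁅y⁆⇒x≡y _ ∈₁))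

      adjacent-flagOf : ∀ d → Adjacent facePoset rank (colour d) (flagOf (init d)) (flagOf (term d))
      adjacent-flagOf d = record
        { agree  = λ F r → let p = edge d (∈-off⁺ (r ∘ ≡.sym)) in mk⇔ (reverse p ++_) (p ++_)
        ; differ = λ { F H ≡.refl _ u~F v~H (≡.refl , F~H) →
            ends-separated d (u~F ++ F~H ++ reverse v~H) }
        }

      adjacent-resp : ∀ {i Φ Φ′ Ψ Ψ′} → Φ ≐ꟳ Φ′ → Ψ ≐ꟳ Ψ′ →
                      Adjacent facePoset rank i Φ Ψ → Adjacent facePoset rank i Φ′ Ψ′
      adjacent-resp (Φ⊆ , Φ⊇) (Ψ⊆ , Ψ⊇) adj = record
        { agree  = λ F r → mk⇔ (λ F∈ → Ψ⊆ (Equivalence.to (agree F r) (Φ⊇ F∈)))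
                               (λ F∈ → Φ⊆ (Equivalence.from (agree F r) (Ψ⊇ F∈)))
        ; differ = λ F H rF rH F∈ H∈ → differ F H rF rH (Φ⊇ F∈) (Ψ⊇ H∈)
        }
        where open Adjacent adj

      adjacent-at : ∀ {d i Φ} → flagOf (init d) ≐ꟳ Φ → colour d ≡ i →
                    Adjacent facePoset rank i Φ (flagOf (term d))
      adjacent-at {d} Φ≐ ≡.refl = adjacent-resp Φ≐ ≐-refl (adjacent-flagOf d)

      -- `Ψ` shares with `init d` all faces of rank other than that of `i`, so its vertex is reached
      -- by colour `i` alone and is `init d` or `term d`. The former would make the faces of that
      -- rank agree.
      adjacent-unique : ∀ {d i Φ Ψ} → flagOf (init d) ≐ꟳ Φ → colour d ≡ i →
                        Adjacent facePoset rank i Φ Ψ → flagOf (term d) ≐ꟳ Ψ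
      adjacent-unique {d} {i} {Φ} {Ψ} Φ≐ colour≡ adj
        with path-single {d = d} ≈ᵥ-refl colour≡
          (path-within intersection ⁅ i ⁆ (proj₂ connected (init d) v) linked)
        where
        v = vertexOf Ψ
        linked : ∀ j → j ∉ ⁅ i ⁆ → init d ~[ properRank j ] v
        linked j j∉ = proj₂ Φ≐ {face (properRank j) v} (Equivalence.from
          (Adjacent.agree adj (face (properRank j) v) λ eq →
            j∉ (≡.subst (_∈ ⁅ i ⁆) (Fin.inject₁-injective (Fin.suc-injective (≡.sym eq))) (x∈⁅x⁆ i)))
          (proj₁ (flagOf-vertexOf Ψ) (nil ≈ᵥ-refl)))
      ... | inj₂ v≈ = ≐-trans (flagOf-cong (≈ᵥ-sym v≈)) (flagOf-vertexOf Ψ)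
      ... | inj₁ v≈ = contradiction (≡.refl , nil ≈ᵥ-refl)
            (Adjacent.differ adj F F ≡.refl ≡.refl
              (proj₁ Φ≐ (nil ≈ᵥ-refl)) (proj₁ (flagOf-vertexOf Ψ) (nil v≈)))
        where F = face (properRank i) (init d)

      path⇒sequence : ∀ {S T u v Φ Ψ} → (∀ {F i} → T F → i ∈ S → rank F ≢ properRank i) →
                      flagOf u ≐ꟳ Φ → flagOf v ≐ꟳ Ψ → T ⊆ subset Φ → Path S u v →
                      FlagSequence facePoset rank T Φ Ψ
      path⇒sequence avoid u≐ v≐ T⊆ (nil u≈v) =
        stop T⊆ (≐-trans (≐-sym u≐) (≐-trans (flagOf-cong u≈v) v≐))
      path⇒sequence avoid u≐ v≐ T⊆ (cons d eq i∈ p) =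
        step T⊆ (colour d) adj (path⇒sequence avoid ≐-refl v≐
          (λ {F} F∈ → Equivalence.to (Adjacent.agree adj F (avoid F∈ i∈)) (T⊆ F∈)) p)
        where adj = adjacent-at {d} (≐-trans (flagOf-cong eq) u≐) ≡.refl

      facePolytope : Polytope n (c ⊔ ℓ)
      facePolytope = record
        { poset     = facePoset
        ; isFlagged = isFlagged
        ; rank      = rank
        ; rank-cong = proj₁
        ; rank-mono = λ { (F≤H , F≉H) → ℕ.≤∧≢⇒< (proj₁ F≤H) λ eq →
            let eq′ = Fin.toℕ-injective eq in F≉H (eq′ , ≤ᶠ-same-rank eq′ (inj₁ F≤H)) }
        ; rank-onto = λ k → face k (proj₁ connected) , ≡.refl
        ; diamond   = diamond
        ; stronglyFlagConnected = stronglyFlagConnected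
        }
        where
        diamond : ∀ Φ i → ∃! _≐ꟳ_ (Adjacent facePoset rank i Φ)
        diamond Φ i =
          let d , init≈ , colour≡ = dart-of-colour (vertexOf Φ) i
              Φ≐ = ≐-trans (flagOf-cong init≈) (flagOf-vertexOf Φ)
          in flagOf (term d) , adjacent-at {d} Φ≐ colour≡ , adjacent-unique {d} Φ≐ colour≡

        stronglyFlagConnected : ∀ Φ Ψ → FlagSequence facePoset rank (subset Φ ∩ subset Ψ) Φ Ψ
        stronglyFlagConnected Φ Ψ =
          path⇒sequence avoid (flagOf-vertexOf Φ) (flagOf-vertexOf Ψ) proj₁
            (path-within intersection S (proj₂ connected u v) linked)
          where
          u = vertexOf Φ
          v = vertexOf Ψ
          -- `S` collects the colours at whose ranks `Φ` and `Ψ` have different faces, so a path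
          -- within `S` keeps every common face.
          separated? : Decidable (λ i → ¬ u ~[ properRank i ] v)
          separated? i = ¬? em
          S = comprehension separated?
          linked : ∀ i → i ∉ S → u ~[ properRank i ] v
          linked i i∉ = decidable-stable em (i∉ ∘ ∈-comprehension⁺ separated?)
          avoid : ∀ {F i} → (subset Φ ∩ subset Ψ) F → i ∈ S → rank F ≢ properRank i
          avoid (F∈Φ , F∈Ψ) i∈ ≡.refl = ∈-comprehension⁻ separated? i∈
            (proj₂ (flagOf-vertexOf Φ) F∈Φ ++ reverse (proj₂ (flagOf-vertexOf Ψ) F∈Ψ))

      vertexOf-cong : ∀ Φ Ψ → Φ ≐ꟳ Ψ → vertexOf Φ ≈ᵥ vertexOf Ψ
      vertexOf-cong Φ Ψ eq = flagOf-injective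
        (≐-trans (flagOf-vertexOf Φ) (≐-trans eq (≐-sym (flagOf-vertexOf Ψ))))

      vertexOf-flagOf : ∀ u → vertexOf (flagOf u) ≈ᵥ u
      vertexOf-flagOf u = flagOf-injective (flagOf-vertexOf (flagOf u))

      ≅-flagGraph : G ≅ flagGraph facePolytope
      ≅-flagGraph = record
        { onVertices = record
          { to        = flagOf
          ; from      = vertexOf
          ; to-cong   = flagOf-cong
          ; from-cong = λ {Φ} {Ψ} → vertexOf-cong Φ Ψ
          ; inverse   = (λ {Φ} eq → ≐-trans (flagOf-cong eq) (flagOf-vertexOf Φ))
                      , (λ {u} {Φ} eq → ≈ᵥ-trans (vertexOf-cong Φ (flagOf u) eq) (vertexOf-flagOf u))
          }
        ; onDarts = record
          { to        = λ d → record { label = colour d ; adjacent = adjacent-flagOf d }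
          ; from      = dartOf
          ; to-cong   = λ eq → colour-cong eq , flagOf-cong (init-cong eq) , flagOf-cong (term-cong eq)
          ; from-cong = λ {e} {e′} (l , s , _) → dart-unique
              (≈ᵥ-trans (init-dartOf e) (≈ᵥ-trans (vertexOf-cong (source e) (source e′) s) (≈ᵥ-sym (init-dartOf e′))))
              (≡.trans (colour-dartOf e) (≡.trans l (≡.sym (colour-dartOf e′))))
          ; inverse   = (λ {e} → inverseˡ {e}) , (λ {d} {e} → inverseʳ {d} {e})
          }
        ; preserves-init   = λ _ → ≐-refl
        ; preserves-term   = λ _ → ≐-refl
        ; preserves-inv    = λ d → ≡.sym (colour-inv d) , flagOf-cong (≈ᵥ-sym (init-inv d))
                                                        , flagOf-cong (≈ᵥ-sym (term-inv d))
        ; preserves-colour = λ _ → ≡.refl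
        }
        where
        open FlagDart

        dartOf : FlagDart facePolytope → Dart
        dartOf e = proj₁ (dart-of-colour (vertexOf (source e)) (label e))
        init-dartOf : ∀ e → init (dartOf e) ≈ᵥ vertexOf (source e)
        init-dartOf e = proj₁ (proj₂ (dart-of-colour (vertexOf (source e)) (label e)))
        colour-dartOf : ∀ e → colour (dartOf e) ≡ label e
        colour-dartOf e = proj₂ (proj₂ (dart-of-colour (vertexOf (source e)) (label e)))

        -- Only source and label determine `dartOf e`; the target agrees because the adjacent flag
        -- of a given label is unique.
        inverseˡ : ∀ {e d} → d ≈ₑ dartOf e →
          colour d ≡ label e × flagOf (init d) ≐ꟳ source e × flagOf (term d) ≐ꟳ target e
        inverseˡ {e} {d} eq = colour≡ , source≐ , adjacent-unique {d} source≐ colour≡ (adjacent e)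
          where
          colour≡ = ≡.trans (colour-cong eq) (colour-dartOf e)
          source≐ = ≐-trans (flagOf-cong (≈ᵥ-trans (init-cong eq) (init-dartOf e)))
                            (flagOf-vertexOf (source e))

        inverseʳ : ∀ {d e} → label e ≡ colour d × source e ≐ꟳ flagOf (init d) ×
                   target e ≐ꟳ flagOf (term d) → dartOf e ≈ₑ d
        inverseʳ {d} {e} (l , s , _) = dart-unique
          (≈ᵥ-trans (init-dartOf e) (≈ᵥ-trans (vertexOf-cong (source e) (flagOf (init d)) s) (vertexOf-flagOf (init d))))
          (≡.trans (colour-dartOf e) l)

maniplex-flagGraph : ExcludedMiddle (c ⊔ ℓ) → (G : ColouredGraph n c ℓ) → ColouredGraph.IsManiplex G →
                     IsFlagGraphOfPolytope (c ⊔ ℓ) G ⇔ PathIntersection G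
maniplex-flagGraph em G M = mk⇔
  (λ (P , iso) → flagGraph⇒intersection G P iso)
  (λ intersection → facePolytope intersection , ≅-flagGraph intersection)
  where open Maniplex.Classical G M em

-- Voltages and paths in the derived graph.

module _ {X : ColouredGraph n c ℓ} {Γ : Group c′ ℓ′} (ξᵛ : VoltageAssignment X Γ) where

  open ColouredGraph X
  open VoltageAssignment ξᵛ
  private
    module Γ = Group Γ
    module D = ColouredGraph (derivedGraph ξᵛ)

  -- A lifted dart multiplies the group coordinate on the left by its voltage, matching the reversed
  -- product in `voltage`; `project` is the converse.
  lift : ∀ {I x y} (p : Path I x y) {g h} → voltage p Γ.∙ g Γ.≈ h → D.Path I (x , g) (y , h)
  lift (nil x≈y) eq = D.nil (x≈y , Γ.trans (Γ.sym (Γ.identityˡ _)) eq)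
  lift (cons d init≈ i∈ p) {g} eq =
    D.cons (d , g) (init≈ , Γ.refl) i∈ (lift p (Γ.trans (Γ.sym (Γ.assoc _ _ _)) eq))

  project : ∀ {I x y g h} → D.Path I (x , g) (y , h) → ∃[ p ] (voltage {I} {x} {y} p Γ.∙ g Γ.≈ h)
  project (D.nil (x≈y , g≈h)) = nil x≈y , Γ.trans (Γ.identityˡ _) g≈h
  project (D.cons (d , _) (init≈ , g′≈g) i∈ p) =
    let q , eq = project p
    in cons d init≈ i∈ q ,
       Γ.trans (Γ.∙-congˡ (Γ.sym g′≈g)) (Γ.trans (Γ.assoc _ _ _) eq)

  VoltageIntersection : Set _
  VoltageIntersection = ∀ I J x y →
    (voltages I x y ∩ voltages J x y) ≐ voltages (I ∩ˢ J) x y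

  intersection-derived : PathIntersection (derivedGraph ξᵛ) ⇔ VoltageIntersection
  intersection-derived = mk⇔ to from
    where
    to : PathIntersection (derivedGraph ξᵛ) → VoltageIntersection
    to intersection I J x y =
      -- Lifts starting at `Γ.ε` end at the voltage itself, so both lifts share their end points.
      (λ ((p , p≈) , (q , q≈)) →
        let r , r≈ = project (intersection I J (lift p (at-ε p≈)) (lift q (at-ε q≈)))
        in r , Γ.trans (Γ.sym (Γ.identityʳ _)) r≈) ,
      (λ (p , p≈) →
        (weakenᵛ (proj₁ ∘ x∈p∩q⁻ I J) p p≈) , (weakenᵛ (proj₂ ∘ x∈p∩q⁻ I J) p p≈))
      where
      at-ε : ∀ {a g} → a Γ.≈ g → a Γ.∙ Γ.ε Γ.≈ g
      at-ε = Γ.trans (Γ.identityʳ _)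
      -- Weakening takes place on the lift, whose end point records the voltage and so preserves it.
      weakenᵛ : ∀ {K L x y g} → K ⊆ˢ L → (p : Path K x y) → voltage p Γ.≈ g → voltages L x y g
      weakenᵛ K⊆L p p≈ =
        let r , r≈ = project (Paths.weaken (derivedGraph ξᵛ) K⊆L (lift p (at-ε p≈)))
        in r , Γ.trans (Γ.sym (Γ.identityʳ _)) r≈
    from : VoltageIntersection → PathIntersection (derivedGraph ξᵛ)
    from intersection I J {x , g} {y , h} p q =
      let p′ , p≈ = project p
          q′ , q≈ = project q
          -- Both projections carry `g` to `h`; cancelling `g` shows that their voltages agree, and
          -- that of `q′` is taken as the common element.
          r  , r≈ = proj₁ (intersection I J x y)
            ((p′ , GroupProperties.∙-cancelʳ Γ g _ _ (Γ.trans p≈ (Γ.sym q≈))) , (q′ , Γ.refl))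
      in lift r (Γ.trans (Γ.∙-congʳ r≈) q≈)

theorem4p1 : ∀ {c ℓ c′ ℓ′ : Level} → ExcludedMiddle (c ⊔ ℓ ⊔ c′ ⊔ ℓ′) →
    ∀ {n : ℕ} (X : ColouredGraph n c ℓ) → ColouredGraph.IsPremaniplex X →
    (Γ : Group c′ ℓ′) (ξ : VoltageAssignment X Γ) →
    ColouredGraph.IsManiplex (derivedGraph ξ) →
    IsFlagGraphOfPolytope (c ⊔ ℓ ⊔ c′ ⊔ ℓ′) (derivedGraph ξ)
    ⇔ (∀ (I J : Subset n) (x y : ColouredGraph.Vertex X) →
    let open VoltageAssignment ξ in
    (voltages I x y ∩ voltages J x y) ≐ voltages (I ∩ˢ J) x y)
theorem4p1 em X _ Γ ξ M =
  intersection-derived ξ ⇔-∘ maniplex-flagGraph em (derivedGraph ξ) M
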